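{- Let $R$ be a proof-structure of $\mathit{IMELL}$ ($\mathtt{cut}$ nodes allowed) such that $R\models\mathsf{AC}$. Then $R\models\mathsf{ACC}_{\sharp\mathsf w}$ if and only if $R$ has exactly one output conclusion.
   Context: $\mathit{IMELL}$ formulae: the atomic formulae are split into output atoms $X$ and their duals $X^\perp$ (input atoms), and $$O::=X\mid\mathbf 1\mid O\otimes O\mid O\wp I\mid I\wp O\mid !O\ \text{(outputs)},\qquad I::=X^\perp\mid\bot\mid I\wp I\mid I\otimes O\mid O\otimes I\mid ?I\ \text{(inputs)}.$$ Linear negation is De Morgan duality ($X/X^\perp$, $\mathbf 1/\bot$, $\otimes/\wp$, $!/?$); it exchanges outputs and inputs. Graphs are finite directed graphs (parallel arcs allowed, no loops); an arc is a conclusion of its tail and a premise of its head. A proof-structure (ps) of $\mathit{IMELL}$ is defined inductively on depth: it is such a graph (the ground structure) without directed cycles, with nodes labelled $\mathtt{ax}$ (2 conclusions, no premise), $\mathtt{cut}$ (2 premises, no conclusion), $\mathtt 1$, $\bot$ or $?\mathtt w$ (1 conclusion, no premise), $\otimes$, $\wp$ or $?\mathtt c$ (2 premises, 1 conclusion; premises ordered for $\otimes,\wp$), $?\mathtt d$ (1 premise, 1 conclusion), $\bullet$ (1 premise, no conclusion), or box node (no premise, one principal conclusion and $k\ge0$ auxiliary conclusions), with a total order on its conclusions (the premises of $\bullet$ nodes); each box node comes with a ps of $\mathit{IMELL}$ (its content) of smaller depth whose conclusions are in bijection with the conclusions of the box node. Arcs are typed by $\mathit{IMELL}$ formulae: dual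 types on the two conclusions of $\mathtt{ax}$ and the two premises of $\mathtt{cut}$; $\mathbf 1$, $\bot$, $B\otimes C$, $B\wp C$ for conclusions of $\mathtt 1,\bot,\otimes,\wp$ nodes; $?\mathtt d$ has premise of type $B$ and conclusion of type $?B$; $?\mathtt c$ has two premises and a conclusion of the same type $?B$; $?\mathtt w$ has conclusion of type $?B$; the principal conclusion of a box has type $!B$ where $B$ is the type of the corresponding conclusion of the content, and each auxiliary conclusion has a type $?C_i$ equal to the type of the corresponding conclusion of the content. An arc is output (input) if its type is; the output conclusions of $R$ are the output arcs among the conclusions of its ground structure. A switching $\varphi$ of the ground structure maps each $\wp$ and each $?\mathtt c$ node to one of its premises; the switching graph is obtained by redirecting the head of the other premise of each such node to a fresh $\bullet$ node (box nodes are treated as single nodes). $R\models\mathsf{AC}$ means that every switching graph of the ground structure has no undirected cycle and, inductively, the content of every box satisfies $\mathsf{AC}$. $R\models\mathsf{ACC}_{\sharp\mathsf w}$ means that $R\models\mathsf{AC}$, every switching graph of the ground structure has exactly (number of $\bot$ and $?\mathtt w$ nodes of the ground structure) $+1$ connected components and, inductively, the content of every box satisfies $\mathsf{ACC}_{\sharp\mathsf w}$. -}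

module Defs where

open import Data.Fin using (Fin; suc; _≟_)
open import Data.Fin.Patterns using (0F; 1F)
open import Data.List using (List; []; _∷_; length; filter; allFin)
open import Data.List.Relation.Unary.Unique.Propositional using (Unique)
open import Data.Nat using (ℕ; suc)
open import Data.Product using (Σ; Σ-syntax; ∃; ∃-syntax; _×_; _,_; proj₁; proj₂)
open import Data.Sum using (_⊎_; inj₁; inj₂)
open import Data.Unit using (⊤)
open import Data.Vec.Functional using (Vector)
open import Function using (_∘_)
open import Function.Bundles using (_↔_; _⇔_; Inverse)
open import Function.Definitions using (Surjective)
open import Level using (0ℓ)
open import Relation.Binary using (Rel; IsTotalOrder)
open import Relation.Binary.Construct.Closure.Equivalence using (EqClosure)
open import Relation.Binary.Construct.Closure.ReflexiveTransitive using (ε; _◅_)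
open import Relation.Binary.Construct.Closure.Symmetric using (fwd; bwd)
open import Relation.Binary.Construct.Closure.Transitive using (TransClosure)
open import Relation.Binary.PropositionalEquality using (_≡_)
open import Relation.Nullary using (¬_; Dec; yes; no)

private
  variable
    Atom : Set

infix  8 !_ ⁇_
infixr 7 _⊗_
infixr 6 _⅋_

-- All MELL formulas; the IMELL ones are those satisfying Output or Input.

data Formula (Atom : Set) : Set where
  var covar : Atom → Formula Atom
  𝟏 ⊥ₘ      : Formula Atom                 -- ⊥ₘ is the unit of ⅋
  _⊗_ _⅋_   : Formula Atom → Formula Atom → Formula Atom
  !_ ⁇_     : Formula Atom → Formula Atom

data Output {Atom : Set} : Formula Atom → Set
data Input  {Atom : Set} : Formula Atom → Set

data Output {Atom} where
  var : ∀ X → Output (var X)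
  𝟏   : Output 𝟏
  o⊗o : ∀ {A B} → Output A → Output B → Output (A ⊗ B)
  o⅋i : ∀ {A B} → Output A → Input B → Output (A ⅋ B)
  i⅋o : ∀ {A B} → Input A → Output B → Output (A ⅋ B)
  !o  : ∀ {A} → Output A → Output (! A)

data Input {Atom} where
  covar : ∀ X → Input (covar X)
  ⊥ₘ    : Input ⊥ₘ
  i⅋i   : ∀ {A B} → Input A → Input B → Input (A ⅋ B)
  i⊗o   : ∀ {A B} → Input A → Output B → Input (A ⊗ B)
  o⊗i   : ∀ {A B} → Output A → Input B → Input (A ⊗ B)
  ⁇i    : ∀ {A} → Input A → Input (⁇ A)

IMELL : Formula Atom → Set
IMELL A = Output A ⊎ Input A

infix 9 _^⊥

_^⊥ : Formula Atom → Formula Atom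
var X ^⊥   = covar X
covar X ^⊥ = var X
𝟏 ^⊥       = ⊥ₘ
⊥ₘ ^⊥      = 𝟏
(A ⊗ B) ^⊥ = A ^⊥ ⅋ B ^⊥
(A ⅋ B) ^⊥ = A ^⊥ ⊗ B ^⊥
(! A) ^⊥   = ⁇ (A ^⊥)
(⁇ A) ^⊥   = ! (A ^⊥)

-- Directed multigraphs. Loops are not excluded here: they are excluded in
-- ground structures by the absence of directed cycles, and hence also in
-- their switching graphs.

record Graph (Node Arc : Set) : Set where
  field
    tail head : Arc → Node

module _ {Node Arc : Set} (G : Graph Node Arc) where
  open Graph G

  Arrow : Rel Node 0ℓ
  Arrow u v = ∃[ a ] (tail a ≡ u × head a ≡ v)

  DirectedAcyclic : Set
  DirectedAcyclic = ∀ v → ¬ TransClosure Arrow v v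

  -- Undirected walks; the type is also the relation of being connected.

  Walk : Rel Node 0ℓ
  Walk = EqClosure Arrow

  arcs : ∀ {u v} → Walk u v → List Arc
  arcs ε                 = []
  arcs (fwd (a , _) ◅ w) = a ∷ arcs w
  arcs (bwd (a , _) ◅ w) = a ∷ arcs w

  -- The nodes visited, without the last one.
  visited : ∀ {u v} → Walk u v → List Node
  visited ε             = []
  visited {u} (_ ◅ w)   = u ∷ visited w

  -- Distinctness of arcs matters for cycles of length two: two parallel arcs
  -- form a cycle, one arc followed back and forth does not.

  IsCycle : ∀ {v} → Walk v v → Set
  IsCycle w = ¬ (arcs w ≡ []) × Unique (arcs w) × Unique (visited w)

  UndirectedAcyclic : Set
  UndirectedAcyclic = ∀ {v} (w : Walk v v) → ¬ IsCycle w

  -- Exactly n connected components: the nodes modulo connectedness are in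
  -- bijection with Fin n.

  HasComponents : ℕ → Set
  HasComponents n =
    Σ[ f ∈ (Node → Fin n) ]
      Surjective _≡_ _≡_ f × (∀ u v → f u ≡ f v ⇔ Walk u v)

data Label : Set where
  ax cut one bot ten par wk ctr der ● : Label
  box : (k : ℕ) → Label                    -- k auxiliary conclusions

#premises : Label → ℕ
#premises ax      = 0
#premises cut     = 2
#premises one     = 0
#premises bot     = 0
#premises ten     = 2
#premises par     = 2
#premises wk      = 0
#premises ctr     = 2
#premises der     = 1
#premises ●       = 1
#premises (box k) = 0

#conclusions : Label → ℕ
#conclusions ax      = 2
#conclusions cut     = 0
#conclusions one     = 1
#conclusions bot     = 1
#conclusions ten     = 1
#conclusions par     = 1
#conclusions wk      = 1
#conclusions ctr     = 1
#conclusions der     = 1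
#conclusions ●       = 0
#conclusions (box k) = suc k               -- the principal one is 0F

data IsBox : Label → Set where
  box : ∀ {k} → IsBox (box k)

data IsSwitched : Label → Set where
  par : IsSwitched par
  ctr : IsSwitched ctr

data IsWeakening : Label → Set where
  bot : IsWeakening bot
  wk  : IsWeakening wk

isSwitched? : ∀ ℓ → Dec (IsSwitched ℓ)
isSwitched? par     = yes par
isSwitched? ctr     = yes ctr
isSwitched? ax      = no λ ()
isSwitched? cut     = no λ ()
isSwitched? one     = no λ ()
isSwitched? bot     = no λ ()
isSwitched? ten     = no λ ()
isSwitched? wk      = no λ ()
isSwitched? der     = no λ ()
isSwitched? ●       = no λ ()
isSwitched? (box k) = no λ ()

isWeakening? : ∀ ℓ → Dec (IsWeakening ℓ)
isWeakening? bot     = yes bot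
isWeakening? wk      = yes wk
isWeakening? ax      = no λ ()
isWeakening? cut     = no λ ()
isWeakening? one     = no λ ()
isWeakening? ten     = no λ ()
isWeakening? par     = no λ ()
isWeakening? ctr     = no λ ()
isWeakening? der     = no λ ()
isWeakening? ●       = no λ ()
isWeakening? (box k) = no λ ()

-- Typing of a node, given the types p of its premises and c of its
-- conclusions. For boxes see BoxTyping.

NodeTyping : ∀ ℓ → Vector (Formula Atom) (#premises ℓ) →
             Vector (Formula Atom) (#conclusions ℓ) → Set
NodeTyping ax      p c = c 0F ≡ c 1F ^⊥
NodeTyping cut     p c = p 0F ≡ p 1F ^⊥
NodeTyping one     p c = c 0F ≡ 𝟏
NodeTyping bot     p c = c 0F ≡ ⊥ₘ
NodeTyping ten     p c = c 0F ≡ p 0F ⊗ p 1F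
NodeTyping par     p c = c 0F ≡ p 0F ⅋ p 1F
NodeTyping wk      p c = ∃[ B ] c 0F ≡ ⁇ B
NodeTyping ctr     p c = ∃[ B ] (p 0F ≡ ⁇ B × p 1F ≡ ⁇ B × c 0F ≡ ⁇ B)
NodeTyping der     p c = c 0F ≡ ⁇ p 0F
NodeTyping ●       p c = ⊤
NodeTyping (box k) p c = ⊤

-- Here d gives the types of the conclusions of the content.

BoxTyping : ∀ {ℓ} → IsBox ℓ →
            (d c : Vector (Formula Atom) (#conclusions ℓ)) → Set
BoxTyping box d c =
  c 0F ≡ ! d 0F × (∀ i → c (suc i) ≡ d (suc i) × (∃[ C ] c (suc i) ≡ ⁇ C))

-- The ground structure is given by its nodes and arcs, where each arc is
-- attached bijectively to a conclusion port (at its tail) and to a premise port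
-- (at its head). Thus a node has exactly as many premises and conclusions as
-- its label prescribes. Ports are numbered for every label, although the
-- numbering of those of ax, cut and ctr plays no role.

record GroundStructure (Atom : Set) : Set₁ where
  field
    #nodes #arcs : ℕ

  Node = Fin #nodes
  Arc  = Fin #arcs

  field
    label : Node → Label

  PremisePort : Node → Set
  PremisePort v = Fin (#premises (label v))

  ConclusionPort : Node → Set
  ConclusionPort v = Fin (#conclusions (label v))

  field
    conclusionPort : Arc ↔ Σ Node ConclusionPort
    premisePort    : Arc ↔ Σ Node PremisePort

  tail : Arc → Node
  tail = proj₁ ∘ Inverse.to conclusionPort

  head : Arc → Node
  head = proj₁ ∘ Inverse.to premisePort

  graph : Graph Node Arc
  graph = record { tail = tail ; head = head }

  premise : ∀ v → PremisePort v → Arc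
  premise v i = Inverse.from premisePort (v , i)

  conclusion : ∀ v → ConclusionPort v → Arc
  conclusion v i = Inverse.from conclusionPort (v , i)

  IsConclusion : Arc → Set
  IsConclusion a = label (head a) ≡ ●

  Conclusion : Set
  Conclusion = Σ Arc IsConclusion

  field
    acyclic      : DirectedAcyclic graph
    _≤ᶜ_         : Rel Conclusion 0ℓ
    isTotalOrder : IsTotalOrder _≡_ _≤ᶜ_
    type         : Arc → Formula Atom
    imell        : ∀ a → IMELL (type a)
    typing       : ∀ v → NodeTyping (label v) (type ∘ premise v) (type ∘ conclusion v)

  IsOutputConclusion : Arc → Set
  IsOutputConclusion a = IsConclusion a × Output (type a)

  BoxNode SwitchedNode : Set
  BoxNode      = Σ[ v ∈ Node ] IsBox (label v)
  SwitchedNode = Σ[ v ∈ Node ] IsSwitched (label v)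

  #w : ℕ
  #w = length (filter (isWeakening? ∘ label) (allFin #nodes))

  Switching : Set
  Switching = ((v , _) : SwitchedNode) → PremisePort v

  -- The node inj₂ s is the fresh ● node for the premise of s that is not
  -- selected.

  switchedHead : Switching → Σ Node PremisePort → Node ⊎ SwitchedNode
  switchedHead φ (v , i) with isSwitched? (label v)
  ... | no  _ = inj₁ v
  ... | yes s with i ≟ φ (v , s)
  ...   | yes _ = inj₁ v
  ...   | no  _ = inj₂ (v , s)

  switchingGraph : Switching → Graph (Node ⊎ SwitchedNode) Arc
  switchingGraph φ = record
    { tail = inj₁ ∘ tail
    ; head = switchedHead φ ∘ Inverse.to premisePort
    }

open GroundStructure

data ProofStructure (Atom : Set) : Set₁

ground : ProofStructure Atom → GroundStructure Atom

-- The map door b is the bijection between the conclusions of the box node b and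
-- those of its content.

data ProofStructure Atom where
  ps : (G : GroundStructure Atom)
       (content : BoxNode G → ProofStructure Atom)
       (door : ∀ b → ConclusionPort G (proj₁ b) ↔ Conclusion (ground (content b))) →
       (∀ b → BoxTyping (proj₂ b)
                (type (ground (content b)) ∘ proj₁ ∘ Inverse.to (door b))
                (type G ∘ conclusion G (proj₁ b))) →
       ProofStructure Atom

ground (ps G _ _ _) = G

AC : ProofStructure Atom → Set
AC (ps G content _ _) =
  (∀ φ → UndirectedAcyclic (switchingGraph G φ)) × (∀ b → AC (content b))

ACC♯w : ProofStructure Atom → Set
ACC♯w R@(ps G content _ _) =
  AC R ×
  (∀ φ → HasComponents (switchingGraph G φ) (suc (#w G))) ×
  (∀ b → ACC♯w (content b))

{-# OPTIONS --safe #-}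
module Submission where

open import Defs
open import Data.Empty using (⊥-elim)
open import Data.Fin using (Fin; zero; suc; _≟_; punchIn; punchOut)
open import Data.Fin.Patterns using (0F; 1F)
open import Data.Fin.Permutation using (↔⇒≡)
open import Data.Fin.Properties
  using (suc-injective; +↔⊎; ¬Fin0; punchInᵢ≢i; punchOut-punchIn; punchOut-cong; punchOut-injective)
open import Data.List using (List; []; _∷_; length; filter; map; tabulate)
import Data.List.Membership.DecPropositional as DecMembership
open import Data.List.Membership.Propositional using (_∈_; _∉_)
open import Data.List.Relation.Unary.All using ([]; _∷_)
open import Data.List.Relation.Unary.All.Properties using (¬Any⇒All¬)
open import Data.List.Relation.Unary.AllPairs using ([]; _∷_)
open import Data.List.Relation.Unary.Any using (here; there)
open import Data.List.Relation.Unary.Unique.Propositional using (Unique)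
import Data.List.Relation.Unary.Unique.Propositional.Properties as Unique
open import Data.Nat using (ℕ; zero; suc; _+_; _*_)
open import Data.Nat.Properties
  using ( +-suc; +-comm; +-identityʳ; +-cancelˡ-≡; +-cancelʳ-≡
        ; +-0-commutativeMonoid; +-commutativeSemigroup )
open import Algebra.Properties.CommutativeMonoid.Sum +-0-commutativeMonoid
  using (sum; sum-cong-≗; sum-replicate-zero; ∑-distrib-+)
open import Algebra.Properties.CommutativeSemigroup +-commutativeSemigroup using (interchange)
open import Data.Product using (Σ; ∃-syntax; ∃!; _×_; _,_; proj₁; proj₂)
open import Data.Product.Algebra using (Σ-assoc)
open import Data.Product.Function.Dependent.Propositional using (Σ-↔)
open import Data.Sum using (_⊎_; inj₁; inj₂)
open import Data.Sum.Function.Propositional using (_⊎-↔_)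
open import Data.Vec.Functional using (Vector)
open import Function using (_∘_; id)
open import Function.Bundles using (_↔_; _⇔_; Inverse; Equivalence; mk⇔; mk↔ₛ′)
open import Function.Construct.Composition using (_↔-∘_)
open import Function.Construct.Identity using (↔-id)
open import Function.Construct.Symmetry using (↔-sym)
open import Function.Definitions using (Surjective)
open import Function.Properties.Inverse using (↔⇒↣)
open import Function.Related.Propositional using (module EquationalReasoning)
open import Relation.Binary using (DecidableEquality)
import Relation.Binary.Construct.Closure.Equivalence as EqClosure
open import Relation.Binary.Construct.Closure.ReflexiveTransitive using (ε; _◅_; _◅◅_)
open import Relation.Binary.Construct.Closure.Symmetric using (fwd; bwd)
open import Relation.Binary.PropositionalEquality
  using (_≡_; _≢_; refl; sym; trans; cong; cong₂; subst; isEquivalence; module ≡-Reasoning)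
open import Relation.Nullary using (¬_; Dec; yes; no; contradiction)
open import Relation.Nullary.Decidable using (via-injection)
open import Relation.Unary using (Decidable)

-- In an undirected forest, components = nodes − arcs. Give each output arc to
-- its tail and each input arc to its head: typing makes every node v receive
-- exactly 1 + [v is ⅋ or ?c] − [v is ⊥ or ?w] − [v is an output conclusion]
-- arcs. Summing over the nodes, a switching graph, which has one more node for
-- each ⅋ or ?c, has #w + #(output conclusions) components. The typing of boxes
-- gives their contents exactly one output conclusion, so the converse
-- direction propagates to all depths.

-- Paths in undirected multigraphs.

module _ {Node Arc : Set} (_≟ₙ_ : DecidableEquality Node) (G : Graph Node Arc) where
  open Graph G
  open DecMembership _≟ₙ_ using (_∈?_)

  -- The endpoint `v`, which `visited` omits, is put in front: the resulting list is what `visited`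
  -- returns once a step from `v` back to `u` closes the path into a cycle.
  IsPath : ∀ {u v} → Walk G u v → Set
  IsPath {v = v} w = Unique (arcs G w) × Unique (v ∷ visited G w)

  Path : Node → Node → Set
  Path u v = Σ (Walk G u v) IsPath

  ∈-insert : ∀ {x y z : Node} {l} → x ∈ y ∷ l → x ∈ y ∷ z ∷ l
  ∈-insert (here eq)   = here eq
  ∈-insert (there x∈l) = there (there x∈l)

  -- Used in contrapositive: an arc with an end off the walk is not among its arcs, so prepending a
  -- step from an unvisited node repeats no arc.
  arc-ends : ∀ {u v} (w : Walk G u v) {a} → a ∈ arcs G w →
             ∀ {x} → x ≡ tail a ⊎ x ≡ head a → x ∈ v ∷ visited G w
  arc-ends (fwd (a , refl , refl) ◅ w) (here refl) (inj₁ refl) = there (here refl)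
  arc-ends (bwd (a , refl , refl) ◅ w) (here refl) (inj₂ refl) = there (here refl)
  arc-ends (fwd (a , refl , refl) ◅ ε) (here refl) (inj₂ refl) = here refl
  arc-ends (bwd (a , refl , refl) ◅ ε) (here refl) (inj₁ refl) = here refl
  arc-ends (fwd (a , refl , refl) ◅ (_ ◅ _)) (here refl) (inj₂ refl) = there (there (here refl))
  arc-ends (bwd (a , refl , refl) ◅ (_ ◅ _)) (here refl) (inj₁ refl) = there (there (here refl))
  arc-ends (fwd (a , _) ◅ w) (there a∈w) e = ∈-insert (arc-ends w a∈w e)
  arc-ends (bwd (a , _) ◅ w) (there a∈w) e = ∈-insert (arc-ends w a∈w e)

  suffix-path : ∀ {u v x} (w : Walk G u v) → IsPath w → x ∈ v ∷ visited G w → Path x v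
  suffix-path w p (here refl) = ε , [] , [] ∷ []
  suffix-path (s ◅ w) p (there (here refl)) = s ◅ w , p
  suffix-path (fwd (a , _) ◅ w) (_ ∷ arcs! , (_ ∷ v∉w) ∷ (_ ∷ visited!)) (there (there x∈w)) =
    suffix-path w (arcs! , v∉w ∷ visited!) (there x∈w)
  suffix-path (bwd (a , _) ◅ w) (_ ∷ arcs! , (_ ∷ v∉w) ∷ (_ ∷ visited!)) (there (there x∈w)) =
    suffix-path w (arcs! , v∉w ∷ visited!) (there x∈w)

  -- Loop erasure from the far end: the rest of the walk is made a path first; if it already visits
  -- `u`, its suffix from `u` suffices, otherwise the step can be prepended.
  walk⇒path : ∀ {u v} → Walk G u v → Path u v
  walk⇒path ε = ε , [] , [] ∷ []
  walk⇒path {u} {v} (s ◅ w) with walk⇒path w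
  ... | w′ , p@(arcs! , v∉w′ ∷ visited!) with u ∈? (v ∷ visited G w′)
  ...   | yes u∈w′ = suffix-path w′ p u∈w′
  ...   | no  u∉w′ = s ◅ w′ , extend s
    where
    v≢u : v ≢ u
    v≢u v≡u = u∉w′ (here (sym v≡u))
    visited′! : Unique (v ∷ u ∷ visited G w′)
    visited′! = (v≢u ∷ v∉w′) ∷ (¬Any⇒All¬ _ (u∉w′ ∘ there) ∷ visited!)
    extend : ∀ s → IsPath (s ◅ w′)
    extend (fwd (a , refl , _)) =
      ¬Any⇒All¬ _ (λ a∈w′ → u∉w′ (arc-ends w′ a∈w′ (inj₁ refl))) ∷ arcs! , visited′!
    extend (bwd (a , _ , refl)) =
      ¬Any⇒All¬ _ (λ a∈w′ → u∉w′ (arc-ends w′ a∈w′ (inj₂ refl))) ∷ arcs! , visited′!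

-- Identifying two elements of a finite set.

merge : ∀ {n} {i j : Fin (suc n)} → i ≢ j → Fin (suc n) → Fin n
merge {j = j} i≢j x with j ≟ x
-- `j` is the element that gets deleted, so it is sent to the image of `i`.
... | yes _   = punchOut (i≢j ∘ sym)
... | no  j≢x = punchOut j≢x

merge-identifies : ∀ {n} {i j : Fin (suc n)} (i≢j : i ≢ j) → merge i≢j i ≡ merge i≢j j
merge-identifies {i = i} {j} i≢j with j ≟ i | j ≟ j
... | yes j≡i | _       = contradiction (sym j≡i) i≢j
... | no  _   | no  j≢j = contradiction refl j≢j
... | no  _   | yes _   = punchOut-cong j refl

merge-kernel : ∀ {n} {i j : Fin (suc n)} (i≢j : i ≢ j) x y → merge i≢j x ≡ merge i≢j y →
               x ≡ y ⊎ (x ≡ j × y ≡ i) ⊎ (x ≡ i × y ≡ j)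
merge-kernel {j = j} i≢j x y eq with j ≟ x | j ≟ y
... | yes j≡x | yes j≡y = inj₁ (trans (sym j≡x) j≡y)
... | yes j≡x | no  j≢y = inj₂ (inj₁ (sym j≡x , sym (punchOut-injective _ j≢y eq)))
... | no  j≢x | yes j≡y = inj₂ (inj₂ (punchOut-injective j≢x _ eq , sym j≡y))
... | no  j≢x | no  j≢y = inj₁ (punchOut-injective j≢x j≢y eq)

merge-surjective : ∀ {n} {i j : Fin (suc n)} (i≢j : i ≢ j) y → ∃[ x ] merge i≢j x ≡ y
merge-surjective {j = j} i≢j y = punchIn j y , eq
  where
  eq : merge i≢j (punchIn j y) ≡ y
  eq with j ≟ punchIn j y
  ... | yes j≡ = contradiction (sym j≡) (punchInᵢ≢i j y)
  ... | no  _  = trans (punchOut-cong j refl) (punchOut-punchIn j)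

-- Components of a forest, counted one arc at a time.

deleteArc : ∀ {Node k} → Graph Node (Fin (suc k)) → Graph Node (Fin k)
deleteArc G = record { tail = tail ∘ suc ; head = head ∘ suc }
  where open Graph G

module _ {Node : Set} {k} (G : Graph Node (Fin (suc k))) where
  open Graph G
  private G⁻ = deleteArc G

  restore : ∀ {u v} → Walk G⁻ u v → Walk G u v
  restore = EqClosure.map λ (a , eqs) → suc a , eqs

  arcs-restore : ∀ {u v} (w : Walk G⁻ u v) → arcs G (restore w) ≡ map suc (arcs G⁻ w)
  arcs-restore ε           = refl
  arcs-restore (fwd _ ◅ w) = cong (_ ∷_) (arcs-restore w)
  arcs-restore (bwd _ ◅ w) = cong (_ ∷_) (arcs-restore w)

  visited-restore : ∀ {u v} (w : Walk G⁻ u v) → visited G (restore w) ≡ visited G⁻ w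
  visited-restore ε       = refl
  visited-restore (_ ◅ w) = cong (_ ∷_) (visited-restore w)

  deleteArc-acyclic : UndirectedAcyclic G → UndirectedAcyclic G⁻
  deleteArc-acyclic acyclic w (nonempty , arcs! , visited!) = acyclic (restore w)
    ( nonempty ∘ map-[] (arcs G⁻ w) ∘ trans (sym (arcs-restore w))
    , subst Unique (sym (arcs-restore w)) (Unique.map⁺ suc-injective arcs!)
    , subst Unique (sym (visited-restore w)) visited! )
    where
    map-[] : (l : List (Fin k)) → map Fin.suc l ≡ [] → l ≡ []
    map-[] [] _ = refl

  -- A walk avoiding arc `zero` shortens to a path between its ends, and `zero`, which is not of the
  -- form `suc a`, closes that path into a cycle.
  deletedArc-disconnects : DecidableEquality Node → UndirectedAcyclic G →
                           ¬ Walk G⁻ (tail zero) (head zero)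
  deletedArc-disconnects _≟ₙ_ acyclic w with walk⇒path _≟ₙ_ G⁻ w
  ... | w′ , arcs! , visited! = acyclic (bwd (zero , refl , refl) ◅ restore w′)
    ( (λ ())
    , subst (Unique ∘ (zero ∷_)) (sym (arcs-restore w′))
        (¬Any⇒All¬ _ (zero∉ (arcs G⁻ w′)) ∷ Unique.map⁺ suc-injective arcs!)
    , subst (Unique ∘ (head zero ∷_)) (sym (visited-restore w′)) visited! )
    where
    zero∉ : (l : List (Fin k)) → zero ∉ map Fin.suc l
    zero∉ (_ ∷ l) (there z∈) = zero∉ l z∈

  -- The restored arc joins two different components, and merging their labels accounts for all the
  -- new connections.
  addArc-components : ∀ {c} → ¬ Walk G⁻ (tail zero) (head zero) →
                      HasComponents G⁻ (suc c) → HasComponents G c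
  addArc-components {c} disconnected (f , f-surj , f-walk) =
    merge i≢j ∘ f , surjective , λ u v → mk⇔ (connect u v) identify
    where
    i≢j : f (tail zero) ≢ f (head zero)
    i≢j = disconnected ∘ Equivalence.to (f-walk _ _)

    surjective : Surjective _≡_ _≡_ (merge i≢j ∘ f)
    surjective y with merge-surjective i≢j y
    ... | x , refl = proj₁ (f-surj x) , λ { refl → cong (merge i≢j) (proj₂ (f-surj x) refl) }

    walk : ∀ u v → f u ≡ f v → Walk G u v
    walk u v = restore ∘ Equivalence.to (f-walk u v)

    connect : ∀ u v → merge i≢j (f u) ≡ merge i≢j (f v) → Walk G u v
    connect u v eq with merge-kernel i≢j (f u) (f v) eq
    ... | inj₁ fu≡fv              = walk u v fu≡fv
    ... | inj₂ (inj₁ (fu≡j , fv≡i)) =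
      walk u _ fu≡j ◅◅ bwd (zero , refl , refl) ◅ walk _ v (sym fv≡i)
    ... | inj₂ (inj₂ (fu≡i , fv≡j)) =
      walk u _ fu≡i ◅◅ fwd (zero , refl , refl) ◅ walk _ v (sym fv≡j)

    identify : ∀ {u v} → Walk G u v → merge i≢j (f u) ≡ merge i≢j (f v)
    identify = EqClosure.gfold isEquivalence (merge i≢j ∘ f) λ where
      (zero  , refl , refl) → merge-identifies i≢j
      (suc a , refl , refl) →
        cong (merge i≢j) (Equivalence.from (f-walk _ _) (fwd (a , refl , refl) ◅ ε))

-- Induction on the arcs: without arcs every node is its own component, and each arc added to a
-- forest lowers the count by one.
forest-components : ∀ {Node n} k (G : Graph Node (Fin k)) → Node ↔ Fin n → UndirectedAcyclic G →
                    ∃[ c ] HasComponents G c × c + k ≡ n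
forest-components {n = n} zero G nodes acyclic =
  n , (to , surjective , λ u v → mk⇔ (connect u v) identify) , +-identityʳ n
  where
  open Inverse nodes
  surjective : Surjective _≡_ _≡_ to
  surjective y = from y , inverseˡ
  connect : ∀ u v → to u ≡ to v → Walk G u v
  connect u v eq = subst (Walk G u) (trans (sym (inverseʳ refl)) (inverseʳ eq)) ε
  identify : ∀ {u v} → Walk G u v → to u ≡ to v
  identify = EqClosure.gfold isEquivalence to λ { (() , _) }
forest-components (suc k) G nodes acyclic
  with forest-components k (deleteArc G) nodes (deleteArc-acyclic G acyclic)
-- The tail of the deleted arc lies in some component, so the count is positive.
... | zero  , (f , _) , _ = ⊥-elim (¬Fin0 (f (Graph.tail G zero)))
... | suc c , components , eq =
  c , addArc-components G (deletedArc-disconnects G _≟ₙ_ acyclic) components , trans (+-suc c k) eq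
  where
  _≟ₙ_ : DecidableEquality _
  _≟ₙ_ = via-injection (↔⇒↣ nodes) _≟_

-- Picking a representative of each component through one labelling and reading its label in the
-- other gives mutually inverse maps.
#components-unique : ∀ {Node Arc} (G : Graph Node Arc) {m n} →
                     HasComponents G m → HasComponents G n → m ≡ n
#components-unique G (f , f-surj , f-walk) (g , g-surj , g-walk) = ↔⇒≡ (mk↔ₛ′
  (g ∘ proj₁ ∘ f-surj) (f ∘ proj₁ ∘ g-surj)
  (λ y → trans (Equivalence.from (g-walk _ _) (Equivalence.to (f-walk _ _) (proj₂ (f-surj _) refl)))
               (proj₂ (g-surj y) refl))
  (λ x → trans (Equivalence.from (f-walk _ _) (Equivalence.to (g-walk _ _) (proj₂ (g-surj _) refl)))
               (proj₂ (f-surj x) refl)))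

-- Finite sums as cardinalities.

sum-1 : ∀ n → sum {n} (λ _ → 1) ≡ n
sum-1 zero    = refl
sum-1 (suc n) = cong suc (sum-1 n)

-- Reduces identities between sums to bijections between the sets they count, by way of `↔⇒≡`.
Σ-Fin↔Fin-sum : ∀ {n} (k : Fin n → ℕ) → Σ (Fin n) (Fin ∘ k) ↔ Fin (sum k)
Σ-Fin↔Fin-sum {zero}  k = mk↔ₛ′ (λ ()) (λ ()) (λ ()) (λ ())
Σ-Fin↔Fin-sum {suc n} k = begin
  Σ (Fin (suc n)) (Fin ∘ k)                    ↔⟨ uncons ⟩
  (Fin (k zero) ⊎ Σ (Fin n) (Fin ∘ k ∘ suc))   ↔⟨ ↔-id _ ⊎-↔ Σ-Fin↔Fin-sum (k ∘ suc) ⟩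
  (Fin (k zero) ⊎ Fin (sum (k ∘ suc)))         ↔⟨ ↔-sym +↔⊎ ⟩
  Fin (k zero + sum (k ∘ suc))                 ∎
  where
  open EquationalReasoning
  uncons : Σ (Fin (suc n)) (Fin ∘ k) ↔ (Fin (k zero) ⊎ Σ (Fin n) (Fin ∘ k ∘ suc))
  uncons = mk↔ₛ′
    (λ { (zero , x) → inj₁ x ; (suc i , x) → inj₂ (i , x) })
    (λ { (inj₁ x) → zero , x ; (inj₂ (i , x)) → suc i , x })
    (λ { (inj₁ _) → refl ; (inj₂ _) → refl })
    (λ { (zero , _) → refl ; (suc _ , _) → refl })

-- Both sides are the size of `Σ (Fin m) (Fin ∘ f)`. With `e` the attachment of arcs to ports, this
-- regroups a sum over arcs by nodes.
sum-fibres : ∀ {m n} {k : Fin n → ℕ} (e : Fin m ↔ Σ (Fin n) (Fin ∘ k)) (f : Fin m → ℕ) →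
             sum f ≡ sum (λ v → sum (λ i → f (Inverse.from e (v , i))))
sum-fibres {m} {n} {k} e f = ↔⇒≡ (begin
  Fin (sum f)                                              ↔⟨ ↔-sym (Σ-Fin↔Fin-sum f) ⟩
  Σ (Fin m) (Fin ∘ f)                                      ↔⟨ ↔-sym (Σ-↔ (↔-sym e) (↔-id _)) ⟩
  Σ (Σ (Fin n) (Fin ∘ k)) (Fin ∘ f ∘ from)                 ↔⟨ Σ-assoc ⟩
  Σ (Fin n) (λ v → Σ (Fin (k v)) (λ i → Fin (f (from (v , i)))))
    ↔⟨ Σ-↔ (↔-id _) (Σ-Fin↔Fin-sum _) ⟩
  Σ (Fin n) (λ v → Fin (sum (λ i → f (from (v , i)))))     ↔⟨ Σ-Fin↔Fin-sum _ ⟩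
  Fin (sum (λ v → sum (λ i → f (from (v , i)))))           ∎)
  where
  open EquationalReasoning
  open Inverse e using (from)

𝟙 : ∀ {P : Set} → Dec P → ℕ
𝟙 (yes _) = 1
𝟙 (no _)  = 0

𝟙-↔ : ∀ {P : Set} (P? : Dec P) → (∀ (x y : P) → x ≡ y) → P ↔ Fin (𝟙 P?)
𝟙-↔ (yes p) irr = mk↔ₛ′ (λ _ → zero) (λ _ → p) (λ { zero → refl }) (irr p)
𝟙-↔ (no ¬p) irr = mk↔ₛ′ (⊥-elim ∘ ¬p) (λ ()) (λ ()) (⊥-elim ∘ ¬p)

length-filter-tabulate : ∀ {A : Set} {P : A → Set} (P? : Decidable P) {n} (f : Fin n → A) →
                         length (filter P? (tabulate f)) ≡ sum (𝟙 ∘ P? ∘ f)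
length-filter-tabulate P? {zero}  f = refl
length-filter-tabulate P? {suc n} f with P? (f zero)
... | yes _ = cong suc (length-filter-tabulate P? (f ∘ suc))
... | no  _ = length-filter-tabulate P? (f ∘ suc)

-- `sum f` is the size of `Σ (Fin n) (Fin ∘ f)`, whose fibre over `i` is a single point if `P i`
-- holds and is empty otherwise.
∃!⇔sum≡1 : ∀ {n} {P : Fin n → Set} (f : Fin n → ℕ) →
           (∀ i → P i → f i ≡ 1) → (∀ i → Fin (f i) → P i) → ∃! _≡_ P ⇔ sum f ≡ 1
∃!⇔sum≡1 {n} {P} f f≡1 witness = mk⇔ to from
  where
  Fin-irrelevant : ∀ {m} → m ≡ 1 → (x y : Fin m) → x ≡ y
  Fin-irrelevant refl 0F 0F = refl

  to : ∃! _≡_ P → sum f ≡ 1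
  to (i , Pi , unique) = ↔⇒≡ (contraction ↔-∘ ↔-sym (Σ-Fin↔Fin-sum f))
    where
    x : Fin (f i)
    x = subst Fin (sym (f≡1 i Pi)) 0F
    centre : ∀ y → (i , x) ≡ y
    centre (j , y) with unique (witness j y)
    ... | refl = cong (i ,_) (Fin-irrelevant (f≡1 i Pi) x y)
    contraction : Σ (Fin n) (Fin ∘ f) ↔ Fin 1
    contraction = mk↔ₛ′ (λ _ → 0F) (λ _ → i , x) (Fin-irrelevant refl 0F) centre

  from : sum f ≡ 1 → ∃! _≡_ P
  -- The preimage of the only element of `Fin 1` is a pair to which every other pair is equal.
  from sum≡1 with Inverse.from e 0F | (λ y → Inverse.inverseʳ e {y} {0F})
    where
    e : Σ (Fin n) (Fin ∘ f) ↔ Fin 1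
    e = subst (λ m → Σ (Fin n) (Fin ∘ f) ↔ Fin m) sum≡1 (Σ-Fin↔Fin-sum f)
  ... | i , x | centre = i , witness i x , λ {j} Pj →
    cong proj₁ (centre (j , subst Fin (sym (f≡1 j Pj)) 0F) (Fin-irrelevant refl 0F _))

-- Output and input counts of formulas.

private
  variable
    Atom : Set
    A B  : Formula Atom

-- Only meaningful on IMELL formulas, where they are 0 or 1.

outputs inputs : Formula Atom → ℕ
outputs (var _)   = 1
outputs (covar _) = 0
outputs 𝟏         = 1
outputs ⊥ₘ        = 0
outputs (A ⊗ B)   = outputs A * outputs B
outputs (A ⅋ B)   = outputs A + outputs B
outputs (! _)     = 1
outputs (⁇ _)     = 0
inputs (var _)   = 0
inputs (covar _) = 1
inputs 𝟏         = 0
inputs ⊥ₘ        = 1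
inputs (A ⊗ B)   = inputs A + inputs B
inputs (A ⅋ B)   = inputs A * inputs B
inputs (! _)     = 0
inputs (⁇ _)     = 1

output-counts : Output A → outputs A ≡ 1 × inputs A ≡ 0
input-counts  : Input A → outputs A ≡ 0 × inputs A ≡ 1
output-counts (var _)   = refl , refl
output-counts 𝟏         = refl , refl
output-counts (o⊗o o p) rewrite proj₁ (output-counts o) | proj₁ (output-counts p)
  | proj₂ (output-counts o) | proj₂ (output-counts p) = refl , refl
output-counts (o⅋i o i) rewrite proj₁ (output-counts o) | proj₁ (input-counts i)
  | proj₂ (output-counts o) = refl , refl
output-counts (i⅋o i o) rewrite proj₁ (output-counts o) | proj₁ (input-counts i)
  | proj₂ (output-counts o) | proj₂ (input-counts i) = refl , refl
output-counts (!o _)    = refl , refl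
input-counts (covar _) = refl , refl
input-counts ⊥ₘ        = refl , refl
input-counts (i⅋i i j) rewrite proj₁ (input-counts i) | proj₁ (input-counts j)
  | proj₂ (input-counts i) | proj₂ (input-counts j) = refl , refl
input-counts (i⊗o i o) rewrite proj₁ (output-counts o) | proj₁ (input-counts i)
  | proj₂ (output-counts o) | proj₂ (input-counts i) = refl , refl
input-counts (o⊗i o i) rewrite proj₁ (output-counts o) | proj₁ (input-counts i)
  | proj₂ (output-counts o) | proj₂ (input-counts i) = refl , refl
input-counts (⁇i _)    = refl , refl

outputs+inputs : IMELL A → outputs A + inputs A ≡ 1
outputs+inputs (inj₁ o) = cong₂ _+_ (proj₁ (output-counts o)) (proj₂ (output-counts o))
outputs+inputs (inj₂ i) = cong₂ _+_ (proj₁ (input-counts i)) (proj₂ (input-counts i))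

-- Serves the `ax` and `cut` nodes: of two dual IMELL types exactly one is an output, so exactly one
-- of the two arcs is assigned to the node.
outputs-^⊥ : (A : Formula Atom) → outputs (A ^⊥) ≡ inputs A
inputs-^⊥  : (A : Formula Atom) → inputs (A ^⊥) ≡ outputs A
outputs-^⊥ (var _)   = refl
outputs-^⊥ (covar _) = refl
outputs-^⊥ 𝟏         = refl
outputs-^⊥ ⊥ₘ        = refl
outputs-^⊥ (A ⊗ B)   = cong₂ _+_ (outputs-^⊥ A) (outputs-^⊥ B)
outputs-^⊥ (A ⅋ B)   = cong₂ _*_ (outputs-^⊥ A) (outputs-^⊥ B)
outputs-^⊥ (! _)     = refl
outputs-^⊥ (⁇ _)     = refl
inputs-^⊥ (var _)   = refl
inputs-^⊥ (covar _) = refl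
inputs-^⊥ 𝟏         = refl
inputs-^⊥ ⊥ₘ        = refl
inputs-^⊥ (A ⊗ B)   = cong₂ _*_ (inputs-^⊥ A) (inputs-^⊥ B)
inputs-^⊥ (A ⅋ B)   = cong₂ _+_ (inputs-^⊥ A) (inputs-^⊥ B)
inputs-^⊥ (! _)     = refl
inputs-^⊥ (⁇ _)     = refl

-- `outputs` is additive on `⅋`, so the four terms regroup into one `outputs+inputs` for each
-- premise.
outputs-⅋+inputs : IMELL A → IMELL B → outputs (A ⅋ B) + (inputs A + inputs B) ≡ 2
outputs-⅋+inputs {A = A} {B = B} a b = trans (interchange (outputs A) _ _ _)
  (cong₂ _+_ (outputs+inputs a) (outputs+inputs b))

⁇-input : IMELL (⁇ A) → Input A
⁇-input (inj₂ (⁇i i)) = i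

-- Arcs assigned to a single node.

#● : Label → ℕ
#● ● = 1
#● _ = 0

-- The negative corrections are moved to the left, which avoids subtraction in `ℕ`. The content of a
-- box enters only through the types `d` of its conclusions.
balance : ∀ ℓ {p : Vector (Formula Atom) (#premises ℓ)} {c : Vector (Formula Atom) (#conclusions ℓ)} →
          NodeTyping ℓ p c → (∀ (b : IsBox ℓ) → ∃[ d ] BoxTyping b d c) →
          (∀ i → IMELL (p i)) → (∀ i → IMELL (c i)) →
          (sum (outputs ∘ c) + sum (inputs ∘ p)) +
            (𝟙 (isWeakening? ℓ) + sum (λ i → #● ℓ * outputs (p i))) ≡
          suc (𝟙 (isSwitched? ℓ))
balance ax {c = c} t _ _ C = begin
  _ ≡⟨ +-identityʳ _ ⟩
  _ ≡⟨ +-identityʳ _ ⟩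
  outputs (c 0F) + (outputs (c 1F) + 0) ≡⟨ cong₂ _+_ (trans (cong outputs t) (outputs-^⊥ (c 1F))) (+-identityʳ _) ⟩
  inputs (c 1F) + outputs (c 1F) ≡⟨ +-comm (inputs (c 1F)) _ ⟩
  outputs (c 1F) + inputs (c 1F) ≡⟨ outputs+inputs (C 1F) ⟩
  1 ∎
  where open ≡-Reasoning
balance cut {p = p} t _ P _ = begin
  _ ≡⟨ +-identityʳ _ ⟩
  inputs (p 0F) + (inputs (p 1F) + 0) ≡⟨ cong₂ _+_ (trans (cong inputs t) (inputs-^⊥ (p 1F))) (+-identityʳ _) ⟩
  outputs (p 1F) + inputs (p 1F) ≡⟨ outputs+inputs (P 1F) ⟩
  1 ∎
  where open ≡-Reasoning
balance one t _ _ _ rewrite t = refl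
balance bot t _ _ _ rewrite t = refl
balance ten {p} {c} t _ _ C = begin
  _ ≡⟨ +-identityʳ _ ⟩
  _ ≡⟨ cong₂ (λ x y → x + (inputs (p 0F) + y)) (trans (+-identityʳ _) (cong outputs t)) (+-identityʳ _) ⟩
  -- `inputs` is additive on `⊗`, so the premises contribute the input count of the conclusion type;
  -- that this type is IMELL excludes two input premises.
  outputs (p 0F ⊗ p 1F) + inputs (p 0F ⊗ p 1F) ≡⟨ outputs+inputs (subst IMELL t (C 0F)) ⟩
  1 ∎
  where open ≡-Reasoning
balance par {p} t _ P _ = begin
  _ ≡⟨ +-identityʳ _ ⟩
  _ ≡⟨ cong₂ (λ x y → x + (inputs (p 0F) + y)) (trans (+-identityʳ _) (cong outputs t)) (+-identityʳ _) ⟩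
  outputs (p 0F ⅋ p 1F) + (inputs (p 0F) + inputs (p 1F)) ≡⟨ outputs-⅋+inputs (P 0F) (P 1F) ⟩
  2 ∎
  where open ≡-Reasoning
balance wk (_ , t) _ _ _ rewrite t = refl
balance ctr (_ , t₀ , t₁ , t) _ _ _ rewrite t₀ | t₁ | t = refl
-- The conclusion `⁇ B` is assigned to its head; being IMELL it forces `B` to be an input, so the
-- premise is the one arc assigned here.
balance der {c = c} t _ _ C
  rewrite t | proj₂ (input-counts (⁇-input (subst IMELL t (C 0F)))) = refl
-- An input premise is assigned to the `●` node; an output premise is counted by the correction term
-- instead.
balance ● {p} _ _ P _ = begin
  inputs (p 0F) + 0 + (outputs (p 0F) + 0 + 0) ≡⟨ cong₂ _+_ (+-identityʳ (inputs (p 0F))) (trans (+-identityʳ _) (+-identityʳ _)) ⟩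
  inputs (p 0F) + outputs (p 0F) ≡⟨ +-comm (inputs (p 0F)) _ ⟩
  outputs (p 0F) + inputs (p 0F) ≡⟨ outputs+inputs (P 0F) ⟩
  1 ∎
  where open ≡-Reasoning
-- Only the principal conclusion, of type `! B`, counts; the auxiliary ones have types `⁇ C`.
balance (box k) {c = c} _ b _ _ with b box
... | d , t , ts = begin
  _ ≡⟨ +-identityʳ _ ⟩
  _ ≡⟨ +-identityʳ _ ⟩
  outputs (c 0F) + sum (λ i → outputs (c (suc i))) ≡⟨ cong₂ _+_ (cong outputs t) (sum-cong-≗ λ i → cong outputs (proj₂ (proj₂ (ts i)))) ⟩
  1 + sum {k} (λ _ → 0) ≡⟨ cong suc (sum-replicate-zero k) ⟩
  1 ∎
  where
  open ≡-Reasoning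

IsSwitched-irrelevant : ∀ {ℓ} (s t : IsSwitched ℓ) → s ≡ t
IsSwitched-irrelevant par par = refl
IsSwitched-irrelevant ctr ctr = refl

-- Global count in a ground structure and its switching graphs.

module _ (G : GroundStructure Atom)
         (boxes : ∀ ((v , b) : GroundStructure.BoxNode G) →
                  ∃[ d ] BoxTyping b d (GroundStructure.type G ∘ GroundStructure.conclusion G v)) where
  open GroundStructure G

  isOutputConclusion : Arc → ℕ
  isOutputConclusion a = #● (label (head a)) * outputs (type a)

  #outputConclusions : ℕ
  #outputConclusions = sum isOutputConclusion

  isSwitched : Node → ℕ
  isSwitched = 𝟙 ∘ isSwitched? ∘ label

  isWeakening : Node → ℕ
  isWeakening = 𝟙 ∘ isWeakening? ∘ label

  head-premise : ∀ v i → head (premise v i) ≡ v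
  head-premise v i = cong proj₁ (Inverse.inverseˡ premisePort refl)

  -- Sum of `balance` over all nodes. By `outputs+inputs` each arc is assigned exactly once, and the
  -- right side is the number of nodes of any switching graph.
  arc-count : #arcs + (#w + #outputConclusions) ≡ #nodes + sum isSwitched
  arc-count = begin
    #arcs + (#w + #outputConclusions)
      ≡⟨ cong₂ _+_ arcs≡ (cong₂ _+_ (length-filter-tabulate (isWeakening? ∘ label) id) conclusions≡) ⟩
    (sum outs + sum ins) + (sum isWeakening + sum concls)
      ≡⟨ cong₂ _+_ (sym (∑-distrib-+ outs ins)) (sym (∑-distrib-+ isWeakening concls)) ⟩
    sum (λ v → outs v + ins v) + sum (λ v → isWeakening v + concls v)
      ≡⟨ sym (∑-distrib-+ (λ v → outs v + ins v) (λ v → isWeakening v + concls v)) ⟩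
    sum (λ v → (outs v + ins v) + (isWeakening v + concls v))
      ≡⟨ sum-cong-≗ (λ v → balance (label v) (typing v) (λ b → boxes (v , b)) (imell ∘ premise v) (imell ∘ conclusion v)) ⟩
    sum (λ v → 1 + isSwitched v)
      ≡⟨ ∑-distrib-+ (λ _ → 1) isSwitched ⟩
    sum {#nodes} (λ _ → 1) + sum isSwitched
      ≡⟨ cong (_+ sum isSwitched) (sum-1 #nodes) ⟩
    #nodes + sum isSwitched ∎
    where
    open ≡-Reasoning
    outs ins concls : Node → ℕ
    outs v   = sum (λ i → outputs (type (conclusion v i)))
    ins v    = sum (λ i → inputs (type (premise v i)))
    concls v = sum (λ i → #● (label v) * outputs (type (premise v i)))

    arcs≡ : #arcs ≡ sum outs + sum ins
    arcs≡ = begin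
      #arcs                                             ≡⟨ sym (sum-1 #arcs) ⟩
      sum {#arcs} (λ _ → 1)                             ≡⟨ sum-cong-≗ (λ a → sym (outputs+inputs (imell a))) ⟩
      sum (λ a → outputs (type a) + inputs (type a))    ≡⟨ ∑-distrib-+ (outputs ∘ type) (inputs ∘ type) ⟩
      sum (outputs ∘ type) + sum (inputs ∘ type)
        ≡⟨ cong₂ _+_ (sum-fibres conclusionPort _) (sum-fibres premisePort _) ⟩
      sum outs + sum ins ∎

    conclusions≡ : #outputConclusions ≡ sum concls
    conclusions≡ = trans (sum-fibres premisePort isOutputConclusion)
      (sum-cong-≗ λ v → sum-cong-≗ λ i →
        -- After regrouping by premise ports, the head of each arc is the node of its port.
        cong (λ u → #● (label u) * outputs (type (premise v i))) (head-premise v i))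

  -- Since `IsSwitched` has at most one proof, each node yields exactly `isSwitched v` fresh nodes.
  switchingNodes : (Node ⊎ SwitchedNode) ↔ Fin (#nodes + sum isSwitched)
  switchingNodes = ↔-sym +↔⊎ ↔-∘ (↔-id _ ⊎-↔
    (Σ-Fin↔Fin-sum isSwitched ↔-∘ Σ-↔ (↔-id _) (𝟙-↔ (isSwitched? _) IsSwitched-irrelevant)))

  -- The forest formula and `arc-count` both express the number of nodes; cancelling `#arcs` leaves
  -- a count independent of `φ`.
  switching-components : ∀ φ → UndirectedAcyclic (switchingGraph φ) →
                         HasComponents (switchingGraph φ) (#w + #outputConclusions)
  switching-components φ acyclic with forest-components #arcs (switchingGraph φ) switchingNodes acyclic
  ... | c , components , eq = subst (HasComponents _)
    (+-cancelʳ-≡ #arcs _ _ (trans eq (trans (sym arc-count) (+-comm #arcs _)))) components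

  uniqueOutput⇔ : ∃! _≡_ IsOutputConclusion ⇔ #outputConclusions ≡ 1
  uniqueOutput⇔ = ∃!⇔sum≡1 isOutputConclusion output⇒1 (λ a → witness (label (head a)) (imell a))
    where
    output⇒1 : ∀ a → IsOutputConclusion a → isOutputConclusion a ≡ 1
    output⇒1 a (●-head , o) rewrite ●-head | proj₁ (output-counts o) = refl

    witness : ∀ ℓ {A} → IMELL A → Fin (#● ℓ * outputs A) → ℓ ≡ ● × Output A
    witness ● (inj₁ o) _ = refl , o
    witness ● (inj₂ i) x rewrite proj₁ (input-counts i) = ⊥-elim (¬Fin0 x)

  -- `ACC♯w` speaks of all switchings; reading a component count off it requires that one exists.
  defaultSwitching : Switching
  defaultSwitching (v , s) = first s
    where
    first : ∀ {ℓ} → IsSwitched ℓ → Fin (#premises ℓ)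
    first par = 0F
    first ctr = 0F

-- Box contents and the two implications.

!-output : IMELL (! A) → Output A
!-output (inj₁ (!o o)) = o

-- The principal type `! B` is IMELL only if `B` is an output, and no `⁇ C` is an output; since
-- `door` is surjective, the content has no other conclusions.
content-uniqueOutput :
  ∀ {ℓ} (b : IsBox ℓ) (G : GroundStructure Atom) → let open GroundStructure G in
  (door : Fin (#conclusions ℓ) ↔ Conclusion) {c : Vector (Formula Atom) (#conclusions ℓ)} →
  BoxTyping b (type ∘ proj₁ ∘ Inverse.to door) c → (∀ i → IMELL (c i)) →
  ∃! _≡_ IsOutputConclusion
content-uniqueOutput box G door {c} (principal , auxiliary) C =
  proj₁ (to 0F) , (proj₂ (to 0F) , !-output (subst IMELL principal (C 0F))) , unique
  where
  open GroundStructure G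
  open Inverse door
  unique : ∀ {a} → IsOutputConclusion a → proj₁ (to 0F) ≡ a
  unique {a} (a● , o) with from (a , a●) | inverseˡ {x = a , a●} refl
  ... | zero  | eq = cong proj₁ eq
  ... | suc i | eq with auxiliary i
  ...   | t , _ , t⁇ with () ← subst Output (trans (cong (type ∘ proj₁) (sym eq)) (trans (sym t) t⁇)) o

-- One switching graph has both `#w + #outputConclusions` and `#w + 1` components, and `#w` cancels.
ACC♯w⇒uniqueOutput : (R : ProofStructure Atom) → ACC♯w R →
                     ∃! _≡_ (GroundStructure.IsOutputConclusion (ground R))
ACC♯w⇒uniqueOutput (ps G content door typed) ((forest , _) , components , _) =
  Equivalence.from (uniqueOutput⇔ G boxes) (+-cancelˡ-≡ #w _ _ (trans
    (#components-unique (switchingGraph φ) (switching-components G boxes φ (forest φ)) (components φ))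
    (+-comm 1 #w)))
  where
  open GroundStructure G
  boxes = λ b → _ , typed b
  φ = defaultSwitching G boxes

-- Induction on depth: at each box the unique output conclusion demanded of the content is supplied
-- by the typing of that box.
uniqueOutput⇒ACC♯w : (R : ProofStructure Atom) → AC R →
                     ∃! _≡_ (GroundStructure.IsOutputConclusion (ground R)) → ACC♯w R
uniqueOutput⇒ACC♯w (ps G content door typed) ac@(forest , content-ac) unique =
  ac ,
  (λ φ → subst (HasComponents _)
    (trans (cong (#w +_) (Equivalence.to (uniqueOutput⇔ G boxes) unique)) (+-comm #w 1))
    (switching-components G boxes φ (forest φ))) ,
  λ b → uniqueOutput⇒ACC♯w (content b) (content-ac b)
    (content-uniqueOutput (proj₂ b) (ground (content b)) (door b) (typed b)
      (imell ∘ conclusion (proj₁ b)))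
  where
  open GroundStructure G
  boxes = λ b → _ , typed b

proposition77 : ∀ (Atom : Set) (R : ProofStructure Atom) → AC R →
    ACC♯w R ⇔ ∃! _≡_ (GroundStructure.IsOutputConclusion (ground R))
proposition77 Atom R ac = mk⇔ (ACC♯w⇒uniqueOutput R) (uniqueOutput⇒ACC♯w R ac)
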